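{- Let $g \ge h \ge 2$ be integers. There is a constant $c>0$ depending only on $g$ and $h$ such that for every positive integer $n$ there exists a weak-$C_h[g]$ set $A \subset \{1,2,\dots,n\}$ with $$|A| \ge c\, n^{\left(1-\frac{1}{h}\right)\left(1-\frac{1}{g}\right)\left(1+\frac{1}{hg-1}\right)}.$$
   Context: A set of integers $A$ is called a weak-$C_h[g]$ set if for every set $X$ of $h$ integers there do not exist $g$ distinct integers $k_1,\dots,k_g$ such that the translates $X+k_1,\dots,X+k_g$ are pairwise disjoint and all contained in $A$ (here $X+k=\{x+k : x\in X\}$). In words, $A$ contains no $g$ pairwise disjoint translates of a common $h$-element set. -}

module Defs where

open import Data.Fin.Base using (Fin)
open import Data.Integer.Base as ℤ using (ℤ; +_; -[1+_])
open import Data.List.Base using (List; length; map)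
open import Data.List.Relation.Binary.Disjoint.Propositional using (Disjoint)
open import Data.List.Relation.Unary.All using (All)
open import Data.List.Relation.Unary.Unique.Propositional using (Unique)
open import Data.Nat.Base as ℕ using (ℕ; suc; NonZero; >-nonZero)
open import Data.Nat.Properties as ℕ using ()
open import Data.Product.Base using (_×_; ∃-syntax)
open import Data.Rational.Base as ℚ using (ℚ; mkℚ; 1ℚ; _/_; +-*-rawSemiring)
open import Function.Definitions using (Injective)
open import Relation.Binary.PropositionalEquality using (_≡_; _≢_)
open import Relation.Nullary.Negation using (¬_)
open import Relation.Unary using (Pred)

open import Algebra.Definitions.RawSemiring +-*-rawSemiring using (_^_)

-- Finite sets of integers are duplicate-free lists; their cardinality is
-- the length.

translate : List ℤ → ℤ → List ℤ
translate X k = map (ℤ._+ k) X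

WeakC : ∀ {ℓ} → ℕ → ℕ → Pred ℤ ℓ → Set ℓ
WeakC h g A =
  (X : List ℤ) → Unique X → length X ≡ h →
  ¬ (∃[ k ] Injective {A = Fin g} _≡_ _≡_ k
          × (∀ i j → i ≢ j → Disjoint (translate X (k i)) (translate X (k j)))
          × (∀ i → All A (translate X (k i))))

fromℕ : ℕ → ℚ
fromℕ m = + m / 1

-- The real inequality  m ≥ c · n ^ e  for c > 0 and n ≥ 1.  Writing e = p / q
-- with q ≥ 1, both sides are nonnegative, so it is equivalent to its q-th
-- power  m ^ q ≥ c ^ q · n ^ p ; a negative p is moved to the left-hand side.
AtLeastPower : (m : ℕ) (c : ℚ) (n : ℕ) (e : ℚ) → Set
AtLeastPower m c n (mkℚ (+ p) q-1 _) =
  fromℕ m ^ suc q-1 ℚ.≥ c ^ suc q-1 ℚ.* fromℕ n ^ p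
AtLeastPower m c n (mkℚ -[1+ p-1 ] q-1 _) =
  fromℕ m ^ suc q-1 ℚ.* fromℕ n ^ suc p-1 ℚ.≥ c ^ suc q-1

hg∸1-nonZero : ∀ {h g} → 2 ℕ.≤ h → h ℕ.≤ g → NonZero (h ℕ.* g ℕ.∸ 1)
hg∸1-nonZero {h} {g} 2≤h h≤g = >-nonZero (ℕ.m<n⇒0<n∸m 1<hg)
  where
  1<hg : 1 ℕ.< h ℕ.* g
  1<hg = ℕ.*-mono-≤ {1} {h} {2} {g} (ℕ.<⇒≤ 2≤h) (ℕ.≤-trans 2≤h h≤g)

exponent : (h g : ℕ) → 2 ℕ.≤ h → h ℕ.≤ g → ℚ
exponent h g 2≤h h≤g =
  (1ℚ ℚ.- + 1 / h) ℚ.* (1ℚ ℚ.- + 1 / g) ℚ.* (1ℚ ℚ.+ + 1 / (h ℕ.* g ℕ.∸ 1))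
  where
  instance
    h≢0 : NonZero h
    h≢0 = >-nonZero (ℕ.<⇒≤ 2≤h)
    g≢0 : NonZero g
    g≢0 = >-nonZero (ℕ.<⇒≤ (ℕ.≤-trans 2≤h h≤g))
    hg∸1≢0 : NonZero (h ℕ.* g ℕ.∸ 1)
    hg∸1≢0 = hg∸1-nonZero 2≤h h≤g

{-# OPTIONS --safe #-}
module Submission where

-- Deletion method.  Pairwise disjoint translates x j + k i (j < h, i < g) form
-- a set of hg integers that is determined by one row and one column of the
-- table, so {1, …, n} contains at most n ^ (h + g - 1) of them.  A random set
-- of density 1 / M contains on average n / M points and at most
-- n ^ (h + g - 1) / M ^ (hg) such tables; for M ^ (hg - 1) ≈ 2 n ^ (h + g - 2)
-- the latter is at most half of the former, and removing one point from every
-- table leaves at least n / (2 M) points.  Finally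
-- 1 - (h + g - 2) / (hg - 1) = (h - 1)(g - 1) / (hg - 1) is the exponent.

open import Defs
open import Algebra.Bundles using (CommutativeRing)
open import Data.Fin.Base using (Fin; zero; suc; toℕ; finToFun; funToFin; remQuot; combine)
open import Data.Fin.Properties as Fin using (toℕ-injective; toℕ<n; any?; finToFun-funToFin; combine-remQuot)
open import Data.Fin.Subset using (Subset; inside; outside; ∣_∣; _-_; Nonempty) renaming (_∈_ to _∈ₛ_; _∉_ to _∉ₛ_; _⊆_ to _⊆ₛ_; _⊈_ to _⊈ₛ_)
open import Data.Fin.Subset.Properties using (drop-there; drop-∷-⊆; p─⊥≡p; p─q⊆p; x∈p∧x≢y⇒x∈p-y; x∈p⇒∣p-x∣<∣p∣)
open import Data.Integer.Base as ℤ using (ℤ; +_; -[1+_]; +≤+)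
import Data.Integer.Properties as ℤ
import Data.Integer.Tactic.RingSolver as ℤ-Solver
open import Data.List.Base using (List; []; _∷_; length; map; filter; lookup; cartesianProductWith; allFin)
open import Data.List.Membership.Propositional using (_∈_)
open import Data.List.Membership.Propositional.Properties using (∈-map⁺; ∈-map⁻; ∈-lookup; ∈-cartesianProductWith⁺; ∈-allFin; ∈-filter⁺)
open import Data.List.Properties using (length-map; length-++; length-tabulate; length-filter)
open import Data.List.Relation.Unary.All as All using (All; []; _∷_)
import Data.List.Relation.Unary.All.Properties as All
open import Data.List.Relation.Unary.AllPairs using ([]; _∷_)
open import Data.List.Relation.Unary.Any using (here; there)
open import Data.List.Relation.Unary.Unique.Propositional using (Unique)
import Data.List.Relation.Unary.Unique.Propositional.Properties as Unique
open import Data.Nat.Base as ℕ using (ℕ; zero; suc; _+_; _*_; _^_; _≤_; z≤n; s≤s; NonZero; >-nonZero)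
open import Data.Nat.Properties
open import Data.Nat.Tactic.RingSolver using (solve-∀)
open import Data.Product.Base using (_×_; _,_; ∃-syntax; proj₁; proj₂; uncurry)
open import Data.Product.Properties using (×-≡,≡→≡)
open import Data.Rational.Base as ℚ using (ℚ; mkℚ; 0ℚ; 1ℚ; toℚᵘ)
import Data.Rational.Properties as ℚ
open import Data.Rational.Unnormalised.Base as ℚᵘ using (mkℚᵘ; _≃_; *≡*)
import Data.Rational.Unnormalised.Properties as ℚᵘ
open import Data.Sum.Base using (_⊎_; inj₁; inj₂)
open import Data.Vec.Base as Vec using ([]; _∷_; here; there)
import Data.Vec.Functional as Functional
open import Data.Vec.Properties using (lookup∘tabulate; lookup⇒[]=; []=⇒lookup)
open import Function.Base using (_∘_; id)
open import Relation.Binary.PropositionalEquality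
open import Relation.Nullary.Decidable using (yes; no; does; dec-true)
open import Relation.Nullary.Negation using (¬_; contradiction)
open import Relation.Unary using (Decidable)

open import Algebra.Definitions.RawSemiring ℚ.+-*-rawSemiring using () renaming (_^_ to _^ℚ_)
open import Algebra.Properties.CommutativeSemiring.Exp (CommutativeRing.commutativeSemiring ℚ.+-*-commutativeRing) using (^-distrib-*)
import Algebra.Properties.AbelianGroup ℤ.+-0-abelianGroup as ℤ-Group

-- Cardinalities of finite subsets

x∉p-x : ∀ {n} (p : Subset n) x → x ∉ₛ p - x
x∉p-x (_ ∷ p) zero    ()
x∉p-x (_ ∷ p) (suc x) x∈ = x∉p-x p x (drop-there x∈)

∣p∣≤1+∣p-x∣ : ∀ {n} (p : Subset n) x → ∣ p ∣ ≤ suc ∣ p - x ∣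
∣p∣≤1+∣p-x∣ (inside  ∷ p) zero = ≤-reflexive (cong (λ p → suc ∣ p ∣) (sym (p─⊥≡p p)))
∣p∣≤1+∣p-x∣ (outside ∷ p) zero = m≤n⇒m≤1+n (≤-reflexive (cong ∣_∣ (sym (p─⊥≡p p))))
∣p∣≤1+∣p-x∣ (inside  ∷ p) (suc x) = s≤s (∣p∣≤1+∣p-x∣ p x)
∣p∣≤1+∣p-x∣ (outside ∷ p) (suc x) = ∣p∣≤1+∣p-x∣ p x

∣p∣≥1⇒nonempty : ∀ {n} (p : Subset n) → 1 ≤ ∣ p ∣ → Nonempty p
∣p∣≥1⇒nonempty (inside  ∷ p) _ = zero , here
∣p∣≥1⇒nonempty (outside ∷ p) 1≤∣p∣ with ∣p∣≥1⇒nonempty p 1≤∣p∣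
... | x , x∈p = suc x , there x∈p

injection⇒≤∣p∣ : ∀ {m n} (p : Subset n) (f : Fin m → Fin n) →
  (∀ {i j} → f i ≡ f j → i ≡ j) → (∀ i → f i ∈ₛ p) → m ≤ ∣ p ∣
injection⇒≤∣p∣ {zero}  p f inj f∈p = z≤n
injection⇒≤∣p∣ {suc m} p f inj f∈p = ≤-trans (s≤s m≤) (x∈p⇒∣p-x∣<∣p∣ (f∈p zero))
  where
  m≤ : m ≤ ∣ p - f zero ∣
  m≤ = injection⇒≤∣p∣ (p - f zero) (f ∘ suc) (Fin.suc-injective ∘ inj)
         (λ i → x∈p∧x≢y⇒x∈p-y (f∈p (suc i)) (λ eq → contradiction (inj eq) λ ()))

-- Hypergraph edges inside a vertex set, and how to break them

contains : ∀ {n} → Subset n → Subset n → ℕ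
contains []            []            = 1
contains (outside ∷ e) (_       ∷ A) = contains e A
contains (inside  ∷ e) (inside  ∷ A) = contains e A
contains (inside  ∷ e) (outside ∷ A) = 0

⊈⊎contains≡1 : ∀ {n} (e A : Subset n) → e ⊈ₛ A ⊎ contains e A ≡ 1
⊈⊎contains≡1 [] [] = inj₂ refl
⊈⊎contains≡1 (outside ∷ e) (_ ∷ A) with ⊈⊎contains≡1 e A
... | inj₁ e⊈A = inj₁ λ e⊆A → e⊈A (drop-∷-⊆ e⊆A)
... | inj₂ eq  = inj₂ eq
⊈⊎contains≡1 (inside ∷ e) (inside ∷ A) with ⊈⊎contains≡1 e A
... | inj₁ e⊈A = inj₁ λ e⊆A → e⊈A (drop-∷-⊆ e⊆A)
... | inj₂ eq  = inj₂ eq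
⊈⊎contains≡1 (inside ∷ e) (outside ∷ A) = inj₁ λ e⊆A → contradiction (e⊆A here) λ ()

edgesIn : ∀ {n} → List (Subset n) → Subset n → ℕ
edgesIn []       A = 0
edgesIn (e ∷ es) A = contains e A + edgesIn es A

-- Only an edge inside `A` costs a point, and `edgesIn` counts that edge with 1, so the loss is at
-- most the number of such edges. Points are only ever removed, hence an edge once broken stays
-- broken.
delete-edges : ∀ {n} (es : List (Subset n)) (A : Subset n) → All (λ e → 1 ≤ ∣ e ∣) es →
  ∃[ B ] B ⊆ₛ A × All (_⊈ₛ B) es × ∣ A ∣ ≤ ∣ B ∣ + edgesIn es A
delete-edges []       A [] = A , (λ x∈A → x∈A) , [] , m≤m+n _ 0
delete-edges (e ∷ es) A (1≤∣e∣ ∷ 1≤∣es∣) with delete-edges es A 1≤∣es∣ | ⊈⊎contains≡1 e A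
... | B , B⊆A , es⊈B , ∣A∣≤ | inj₁ e⊈A =
  B , B⊆A , (λ e⊆B → e⊈A λ x∈e → B⊆A (e⊆B x∈e)) ∷ es⊈B ,
  ≤-trans ∣A∣≤ (+-monoʳ-≤ ∣ B ∣ (m≤n+m _ (contains e A)))
... | B , B⊆A , es⊈B , ∣A∣≤ | inj₂ eq with ∣p∣≥1⇒nonempty e 1≤∣e∣
... | x , x∈e =
  -- `x` is any point of `e`. It may already be missing from `B`, and then nothing is lost.
  B - x , (λ y∈ → B⊆A (B-x⊆B y∈)) ,
  (λ e⊆ → x∉p-x B x (e⊆ x∈e)) ∷
  All.map (λ f⊈B f⊆ → f⊈B λ y∈f → B-x⊆B (f⊆ y∈f)) es⊈B , bound
  where
  B-x⊆B : B - x ⊆ₛ B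
  B-x⊆B = p─q⊆p B _
  bound : ∣ A ∣ ≤ ∣ B - x ∣ + (contains e A + edgesIn es A)
  bound rewrite eq | +-suc ∣ B - x ∣ (edgesIn es A) = ≤-trans ∣A∣≤ (+-monoˡ-≤ _ (∣p∣≤1+∣p-x∣ B x))

-- First moments of a random subset

module _ (q : ℕ) where

  -- Up to the factor (1 + q) ^ n, this is the expectation of Φ over a random
  -- subset containing each element independently with probability 1 / (1 + q).
  weightedSum : ∀ n → (Subset n → ℕ) → ℕ
  weightedSum zero    Φ = Φ []
  weightedSum (suc n) Φ = weightedSum n (Φ ∘ (inside ∷_)) + q * weightedSum n (Φ ∘ (outside ∷_))

  weightedSum-+ : ∀ n Φ Ψ →
    weightedSum n (λ A → Φ A + Ψ A) ≡ weightedSum n Φ + weightedSum n Ψ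
  weightedSum-+ zero    Φ Ψ = refl
  weightedSum-+ (suc n) Φ Ψ = trans
    (cong₂ (λ x y → x + q * y) (weightedSum-+ n (Φ ∘ (inside ∷_)) (Ψ ∘ (inside ∷_)))
                               (weightedSum-+ n (Φ ∘ (outside ∷_)) (Ψ ∘ (outside ∷_))))
    (rearrange q (weightedSum n (Φ ∘ (inside ∷_))) (weightedSum n (Ψ ∘ (inside ∷_))) _ _)
    where
    rearrange : ∀ q a b c d → (a + b) + q * (c + d) ≡ (a + q * c) + (b + q * d)
    rearrange = solve-∀

  weightedSum-* : ∀ n k Φ → weightedSum n (λ A → k * Φ A) ≡ k * weightedSum n Φ
  weightedSum-* zero    k Φ = refl
  weightedSum-* (suc n) k Φ = trans
    (cong₂ (λ x y → x + q * y) (weightedSum-* n k (Φ ∘ (inside ∷_)))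
                               (weightedSum-* n k (Φ ∘ (outside ∷_))))
    (rearrange q k (weightedSum n (Φ ∘ (inside ∷_))) _)
    where
    rearrange : ∀ q k a b → k * a + q * (k * b) ≡ k * (a + q * b)
    rearrange = solve-∀

  weightedSum-const : ∀ n k → weightedSum n (λ _ → k) ≡ k * suc q ^ n
  weightedSum-const zero    k = sym (*-identityʳ k)
  weightedSum-const (suc n) k = trans
    (cong (λ x → x + q * x) (weightedSum-const n k)) (rearrange q k (suc q ^ n))
    where
    rearrange : ∀ q k x → k * x + q * (k * x) ≡ k * (suc q * x)
    rearrange = solve-∀

  -- The expected size is n / (1 + q); the factor `suc q` on the left keeps the identity in the
  -- natural numbers. A new coordinate adds a point only on the inside branch, which has weight 1.
  weightedSum-size : ∀ n → suc q * weightedSum n ∣_∣ ≡ n * suc q ^ n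
  weightedSum-size zero    = *-zeroʳ (suc q)
  weightedSum-size (suc n) = begin
    suc q * (weightedSum n (λ A → 1 + ∣ A ∣) + q * w) ≡⟨ cong (λ x → suc q * (x + q * w)) (weightedSum-+ n (λ _ → 1) ∣_∣) ⟩
    suc q * ((weightedSum n (λ _ → 1) + w) + q * w)   ≡⟨ cong (λ x → suc q * ((x + w) + q * w)) (weightedSum-const n 1) ⟩
    suc q * ((1 * suc q ^ n + w) + q * w)             ≡⟨ rearrange q w (suc q ^ n) ⟩
    suc q * suc q ^ n + suc q * (suc q * w)           ≡⟨ cong (λ x → suc q * suc q ^ n + suc q * x) (weightedSum-size n) ⟩
    suc q * suc q ^ n + suc q * (n * suc q ^ n)       ≡⟨ rearrange′ q n (suc q ^ n) ⟩
    suc n * (suc q * suc q ^ n)                       ∎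
    where
    open ≡-Reasoning
    w : ℕ
    w = weightedSum n ∣_∣
    rearrange : ∀ q w x → suc q * ((1 * x + w) + q * w) ≡ suc q * x + suc q * (suc q * w)
    rearrange = solve-∀
    rearrange′ : ∀ q n x → suc q * x + suc q * (n * x) ≡ suc n * (suc q * x)
    rearrange′ = solve-∀

  -- A coordinate in `e` leaves only the inside branch and contributes 1 instead of `suc q`, so `e`
  -- lies in the random set with probability 1 / (1 + q) to the power `∣ e ∣`.
  weightedSum-contains : ∀ {n} (e : Subset n) →
    suc q ^ ∣ e ∣ * weightedSum n (contains e) ≡ suc q ^ n
  weightedSum-contains [] = refl
  weightedSum-contains {suc n} (inside ∷ e) = trans
    (cong (λ x → suc q ^ suc ∣ e ∣ * (weightedSum n (contains e) + q * x)) (weightedSum-const n 0))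
    (trans (rearrange q (suc q ^ ∣ e ∣) (weightedSum n (contains e)))
           (cong (suc q *_) (weightedSum-contains e)))
    where
    rearrange : ∀ q x y → (suc q * x) * (y + q * 0) ≡ suc q * (x * y)
    rearrange = solve-∀
  weightedSum-contains {suc n} (outside ∷ e) = trans
    (rearrange q (suc q ^ ∣ e ∣) (weightedSum n (contains e)))
    (cong (suc q *_) (weightedSum-contains e))
    where
    rearrange : ∀ q x y → x * (y + q * y) ≡ suc q * (x * y)
    rearrange = solve-∀

  -- Linearity of expectation; edges with more than `r` points are no more likely to lie inside the
  -- random set.
  weightedSum-edgesIn : ∀ {n r} (es : List (Subset n)) → All (λ e → r ≤ ∣ e ∣) es →
    suc q ^ r * weightedSum n (edgesIn es) ≤ length es * suc q ^ n
  weightedSum-edgesIn {n} {r} [] [] =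
    ≤-reflexive (trans (cong (suc q ^ r *_) (weightedSum-const n 0)) (*-zeroʳ (suc q ^ r)))
  weightedSum-edgesIn {n} {r} (e ∷ es) (r≤∣e∣ ∷ r≤∣es∣) = begin
    suc q ^ r * weightedSum n (edgesIn (e ∷ es))
      ≡⟨ cong (suc q ^ r *_) (weightedSum-+ n (contains e) (edgesIn es)) ⟩
    suc q ^ r * (weightedSum n (contains e) + weightedSum n (edgesIn es))
      ≡⟨ *-distribˡ-+ (suc q ^ r) _ _ ⟩
    suc q ^ r * weightedSum n (contains e) + suc q ^ r * weightedSum n (edgesIn es)
      ≤⟨ +-mono-≤ (*-monoˡ-≤ _ (^-monoʳ-≤ (suc q) r≤∣e∣)) (weightedSum-edgesIn es r≤∣es∣) ⟩
    suc q ^ ∣ e ∣ * weightedSum n (contains e) + length es * suc q ^ n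
      ≡⟨ cong (_+ length es * suc q ^ n) (weightedSum-contains e) ⟩
    suc q ^ n + length es * suc q ^ n ∎
    where open ≤-Reasoning

  -- Method of conditional expectations: coordinates are fixed one at a time, and at least one of
  -- the two choices preserves the inequality between the sums.
  weightedSum-≤⇒∃≤ : ∀ n Φ Ψ → weightedSum n Φ ≤ weightedSum n Ψ → ∃[ A ] Φ A ≤ Ψ A
  weightedSum-≤⇒∃≤ zero    Φ Ψ Φ≤Ψ = [] , Φ≤Ψ
  weightedSum-≤⇒∃≤ (suc n) Φ Ψ Φ≤Ψ
    with weightedSum n (Φ ∘ (inside ∷_)) ≤? weightedSum n (Ψ ∘ (inside ∷_))
       | weightedSum n (Φ ∘ (outside ∷_)) ≤? weightedSum n (Ψ ∘ (outside ∷_))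
  ... | yes le | _ with A , ΦA≤ΨA ← weightedSum-≤⇒∃≤ n _ _ le = inside ∷ A , ΦA≤ΨA
  ... | no _ | yes le with A , ΦA≤ΨA ← weightedSum-≤⇒∃≤ n _ _ le = outside ∷ A , ΦA≤ΨA
  ... | no ≰ | no ≰′ =
    -- The inside branch has weight 1 and supplies strictness; the outside branch has weight `q`,
    -- possibly 0, and gives only a weak inequality.
    contradiction Φ≤Ψ (<⇒≱ (+-mono-<-≤ (≰⇒> ≰) (*-monoʳ-≤ q (<⇒≤ (≰⇒> ≰′)))))

  -- By `few`, the expected number of edges inside the random set times `2 * suc q` is at most `n`,
  -- while the same multiple of the expected size is 2n. Hence some `A` is good enough for deletion.
  -- The averaged inequality adds on the left where the usual argument subtracts.
  large-independent-set : ∀ {n r} (es : List (Subset n)) → 1 ≤ r → All (λ e → r ≤ ∣ e ∣) es →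
    2 * length es * suc q ≤ n * suc q ^ r →
    ∃[ B ] All (_⊈ₛ B) es × n ≤ 2 * suc q * ∣ B ∣
  large-independent-set {n} {r} es 1≤r r≤∣es∣ few
    with weightedSum-≤⇒∃≤ n (λ A → 2 * suc q * edgesIn es A + n) (λ A → 2 * suc q * ∣ A ∣) average
    where
    open ≤-Reasoning
    M = suc q
    W : (Subset n → ℕ) → ℕ
    W = weightedSum n
    rearrange : ∀ a b c d → a * (2 * b * c + d) ≡ 2 * b * (a * c) + a * d
    rearrange = solve-∀
    rearrange′ : ∀ l m x n y → 2 * m * (l * x) + y * (n * x) ≡ (2 * l * m) * x + n * y * x
    rearrange′ = solve-∀
    rearrange″ : ∀ n y x → n * y * x + n * y * x ≡ y * (2 * (n * x))
    rearrange″ = solve-∀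
    average : W (λ A → 2 * M * edgesIn es A + n) ≤ W (λ A → 2 * M * ∣ A ∣)
    -- The factor `M ^ r` clears the denominators of the edge probabilities.
    average = *-cancelˡ-≤ (M ^ r) {{m^n≢0 M r}} (begin
      M ^ r * W (λ A → 2 * M * edgesIn es A + n)
        ≡⟨ cong (M ^ r *_) (weightedSum-+ n (λ A → 2 * M * edgesIn es A) (λ _ → n)) ⟩
      M ^ r * (W (λ A → 2 * M * edgesIn es A) + W (λ _ → n))
        ≡⟨ cong₂ (λ x y → M ^ r * (x + y)) (weightedSum-* n (2 * M) (edgesIn es)) (weightedSum-const n n) ⟩
      M ^ r * (2 * M * W (edgesIn es) + n * M ^ n)
        ≡⟨ rearrange (M ^ r) M (W (edgesIn es)) (n * M ^ n) ⟩
      2 * M * (M ^ r * W (edgesIn es)) + M ^ r * (n * M ^ n)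
        ≤⟨ +-monoˡ-≤ _ (*-monoʳ-≤ (2 * M) (weightedSum-edgesIn es r≤∣es∣)) ⟩
      2 * M * (length es * M ^ n) + M ^ r * (n * M ^ n)
        ≡⟨ rearrange′ (length es) M (M ^ n) n (M ^ r) ⟩
      (2 * length es * M) * M ^ n + n * M ^ r * M ^ n
        ≤⟨ +-monoˡ-≤ _ (*-monoˡ-≤ (M ^ n) few) ⟩
      n * M ^ r * M ^ n + n * M ^ r * M ^ n
        ≡⟨ rearrange″ n (M ^ r) (M ^ n) ⟩
      M ^ r * (2 * (n * M ^ n))
        ≡⟨ cong (λ x → M ^ r * (2 * x)) (sym (weightedSum-size n)) ⟩
      M ^ r * (2 * (M * W ∣_∣))
        ≡⟨ cong (M ^ r *_) (sym (*-assoc 2 M (W ∣_∣))) ⟩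
      M ^ r * (2 * M * W ∣_∣)
        ≡⟨ cong (M ^ r *_) (sym (weightedSum-* n (2 * M) ∣_∣)) ⟩
      M ^ r * W (λ A → 2 * M * ∣ A ∣) ∎)
  ... | A , many with delete-edges es A (All.map (≤-trans 1≤r) r≤∣es∣)
  ... | B , _ , es⊈B , ∣A∣≤ = B , es⊈B , +-cancelˡ-≤ (2 * suc q * edgesIn es A) _ _ (begin
    2 * suc q * edgesIn es A + n                         ≤⟨ many ⟩
    2 * suc q * ∣ A ∣                                    ≤⟨ *-monoʳ-≤ (2 * suc q) ∣A∣≤ ⟩
    2 * suc q * (∣ B ∣ + edgesIn es A)                   ≡⟨ *-distribˡ-+ (2 * suc q) ∣ B ∣ _ ⟩
    2 * suc q * ∣ B ∣ + 2 * suc q * edgesIn es A         ≡⟨ +-comm (2 * suc q * ∣ B ∣) _ ⟩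
    2 * suc q * edgesIn es A + 2 * suc q * ∣ B ∣         ∎)
    where open ≤-Reasoning

-- Finite subsets from decidable predicates, and their lists of elements

comprehension : ∀ {n} {P : Fin n → Set} → Decidable P → Subset n
comprehension P? = Vec.tabulate (does ∘ P?)

∈-comprehension⁺ : ∀ {n} {P : Fin n → Set} (P? : Decidable P) {x} → P x → x ∈ₛ comprehension P?
∈-comprehension⁺ P? {x} px =
  lookup⇒[]= x _ (trans (lookup∘tabulate (does ∘ P?) x) (dec-true (P? x) px))

∈-comprehension⁻ : ∀ {n} {P : Fin n → Set} (P? : Decidable P) {x} → x ∈ₛ comprehension P? → P x
∈-comprehension⁻ P? {x} x∈ with P? x | trans (sym (lookup∘tabulate (does ∘ P?) x)) ([]=⇒lookup x∈)
... | yes px | _ = px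

elements : ∀ {n} → Subset n → List (Fin n)
elements []            = []
elements (inside  ∷ p) = zero ∷ map suc (elements p)
elements (outside ∷ p) = map suc (elements p)

length-elements : ∀ {n} (p : Subset n) → length (elements p) ≡ ∣ p ∣
length-elements []            = refl
length-elements (inside  ∷ p) = cong suc (trans (length-map suc (elements p)) (length-elements p))
length-elements (outside ∷ p) = trans (length-map suc (elements p)) (length-elements p)

elements-unique : ∀ {n} (p : Subset n) → Unique (elements p)
elements-unique []            = []
elements-unique (inside  ∷ p) =
  All.map⁺ (All.universal (λ _ ()) (elements p)) ∷ Unique.map⁺ Fin.suc-injective (elements-unique p)
elements-unique (outside ∷ p) = Unique.map⁺ Fin.suc-injective (elements-unique p)

∈-elements⁻ : ∀ {n} (p : Subset n) {x} → x ∈ elements p → x ∈ₛ p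
∈-elements⁻ (inside ∷ p) (here refl) = here
∈-elements⁻ (inside ∷ p) (there x∈) with ∈-map⁻ suc x∈
... | _ , y∈ , refl = there (∈-elements⁻ p y∈)
∈-elements⁻ (outside ∷ p) x∈ with ∈-map⁻ suc x∈
... | _ , y∈ , refl = there (∈-elements⁻ p y∈)

lookup-injective : ∀ {A : Set} {xs : List A} → Unique xs →
  ∀ {i j} → lookup xs i ≡ lookup xs j → i ≡ j
lookup-injective (_  ∷ _) {zero}  {zero}  _  = refl
lookup-injective (x∉ ∷ _) {zero}  {suc j} eq = contradiction eq (All.lookup x∉ (∈-lookup j))
lookup-injective (x∉ ∷ _) {suc i} {zero}  eq = contradiction (sym eq) (All.lookup x∉ (∈-lookup i))
lookup-injective (_  ∷ u) {suc i} {suc j} eq = cong suc (lookup-injective u eq)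

length-cartesianProductWith : ∀ {A B C : Set} (f : A → B → C) xs ys →
  length (cartesianProductWith f xs ys) ≡ length xs * length ys
length-cartesianProductWith f []       ys = refl
length-cartesianProductWith f (x ∷ xs) ys = trans (length-++ (map (f x) ys))
  (cong₂ _+_ (length-map (f x) ys) (length-cartesianProductWith f xs ys))

-- The element i of Fin n stands for the integer i + 1.
value : ∀ {n} → Fin n → ℤ
value i = + suc (toℕ i)

value-injective : ∀ {n} {i j : Fin n} → value i ≡ value j → i ≡ j
value-injective eq = toℕ-injective (suc-injective (ℤ.+-injective eq))

values : ∀ {n} → Subset n → List ℤ
values p = map value (elements p)

values-unique : ∀ {n} (p : Subset n) → Unique (values p)
values-unique p = Unique.map⁺ value-injective (elements-unique p)

values-bounds : ∀ {n} (p : Subset n) → All (λ a → + 1 ℤ.≤ a × a ℤ.≤ + n) (values p)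
values-bounds p =
  All.map⁺ (All.universal (λ i → +≤+ (s≤s z≤n) , +≤+ (toℕ<n i)) (elements p))

length-values : ∀ {n} (p : Subset n) → length (values p) ≡ ∣ p ∣
length-values p = trans (length-map value (elements p)) (length-elements p)

∈-values⁻ : ∀ {n} (p : Subset n) {a} → a ∈ values p → ∃[ x ] x ∈ₛ p × a ≡ value x
∈-values⁻ p a∈ with ∈-map⁻ value a∈
... | x , x∈ , eq = x , ∈-elements⁻ p x∈ , eq

-- Grids rebuilt from one row and one column

module _ {n h g : ℕ} where

  -- A table a j i = x j + k i is determined by b j = a j 0 and c i = a 0 (1 + i),
  -- because a j i + a 0 0 = a j 0 + a 0 i; out-of-range entries are dropped.
  InGrid : (Fin (suc h) → Fin n) → (Fin g → Fin n) → Fin n → Set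
  InGrid b c v = ∃[ j ] ∃[ i ] toℕ v + toℕ (b zero) ≡ toℕ (b j) + toℕ ((b zero Functional.∷ c) i)

  inGrid? : ∀ b c → Decidable (InGrid b c)
  inGrid? b c v = any? λ j → any? λ i →
    toℕ v + toℕ (b zero) ≟ toℕ (b j) + toℕ ((b zero Functional.∷ c) i)

  grid : (Fin (suc h) → Fin n) → (Fin g → Fin n) → Subset n
  grid b c = comprehension (inGrid? b c)

  -- Decoding a coded function returns it only up to pointwise equality, so grid membership has to
  -- be transported along `≗`.
  InGrid-resp : ∀ {b b′ c c′ v} → b ≗ b′ → c ≗ c′ → InGrid b c v → InGrid b′ c′ v
  InGrid-resp {v = v} b≗ c≗ (j , zero , eq) = j , zero ,
    subst₂ (λ x y → toℕ v + toℕ x ≡ toℕ y + toℕ x) (b≗ zero) (b≗ j) eq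
  InGrid-resp {v = v} b≗ c≗ (j , suc i , eq) = j , suc i ,
    trans (cong (λ x → toℕ v + toℕ x) (sym (b≗ zero)))
      (trans eq (cong₂ (λ x y → toℕ x + toℕ y) (b≗ j) (c≗ i)))

-- Coding both functions as numbers below `n ^ suc h` and `n ^ g` makes the grids a list of known
-- length.
codedGrid : ∀ {n} h g → Fin (n ^ suc h) → Fin (n ^ g) → Subset n
codedGrid h g s t = grid {h = h} {g} (finToFun s) (finToFun t)

-- All codes are listed, also those whose grid has coinciding or missing entries; a size condition
-- excludes these later.
grids : ∀ n h g → List (Subset n)
grids n h g = cartesianProductWith (codedGrid h g) (allFin (n ^ suc h)) (allFin (n ^ g))

length-grids : ∀ n h g → length (grids n h g) ≡ n ^ suc h * n ^ g
length-grids n h g = trans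
  (length-cartesianProductWith (codedGrid h g) (allFin (n ^ suc h)) (allFin (n ^ g)))
  (cong₂ _*_ (length-tabulate {n = n ^ suc h} id) (length-tabulate {n = n ^ g} id))

module _ {n h g : ℕ} (a : Fin (suc h) → Fin (suc g) → Fin n) where

  private
    row : Fin (suc h) → Fin n
    row j = a j zero

    column : Fin g → Fin n
    column i = a zero (suc i)

    column-∷ : ∀ i → (row zero Functional.∷ column) i ≡ a zero i
    column-∷ zero    = refl
    column-∷ (suc i) = refl

  gridOf : Subset n
  gridOf = codedGrid h g (funToFin row) (funToFin column)

  gridOf∈grids : gridOf ∈ grids n h g
  gridOf∈grids = ∈-cartesianProductWith⁺ (codedGrid h g)
    (∈-allFin (funToFin row)) (∈-allFin (funToFin column))

  module _ (parallelogram : ∀ j i →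
    toℕ (a j i) + toℕ (a zero zero) ≡ toℕ (a j zero) + toℕ (a zero i)) where

    private
      -- The parallelogram identity says that `a j i` solves the equation defining `v`, and by
      -- cancellation that solution is unique, so `v` is an entry of the table.
      InGrid⇒∈ : ∀ {A v} → (∀ j i → a j i ∈ₛ A) → InGrid row column v → v ∈ₛ A
      InGrid⇒∈ {A} a∈A (j , i , eq) = subst (_∈ₛ A) (toℕ-injective (+-cancelʳ-≡ (toℕ (row zero)) _ _
        (trans (parallelogram j i) (sym (trans eq (cong (λ z → toℕ (row j) + toℕ z) (column-∷ i)))))))
        (a∈A j i)

      entry-InGrid : ∀ j i → InGrid row column (a j i)
      entry-InGrid j i =
        j , i , trans (parallelogram j i) (cong (λ z → toℕ (row j) + toℕ z) (sym (column-∷ i)))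

    gridOf⊆ : ∀ {A} → (∀ j i → a j i ∈ₛ A) → gridOf ⊆ₛ A
    gridOf⊆ a∈A v∈ = InGrid⇒∈ a∈A (InGrid-resp (finToFun-funToFin row) (finToFun-funToFin column)
      (∈-comprehension⁻ (inGrid? (finToFun (funToFin row)) (finToFun (funToFin column))) v∈))

    ∈-gridOf⁺ : ∀ j i → a j i ∈ₛ gridOf
    ∈-gridOf⁺ j i = ∈-comprehension⁺ (inGrid? (finToFun (funToFin row)) (finToFun (funToFin column)))
      (InGrid-resp (sym ∘ finToFun-funToFin row) (sym ∘ finToFun-funToFin column) (entry-InGrid j i))

    -- Distinct entries embed the index pairs, coded in `Fin (suc h * suc g)`, into the grid.
    ∣gridOf∣≥ : (∀ j i j′ i′ → a j i ≡ a j′ i′ → j ≡ j′ × i ≡ i′) → suc h * suc g ≤ ∣ gridOf ∣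
    ∣gridOf∣≥ a-injective =
      injection⇒≤∣p∣ gridOf entry injective (λ s → uncurry ∈-gridOf⁺ (remQuot {suc h} (suc g) s))
      where
      entry : Fin (suc h * suc g) → Fin n
      entry s = uncurry a (remQuot {suc h} (suc g) s)
      injective : ∀ {s t} → entry s ≡ entry t → s ≡ t
      injective {s} {t} eq = trans (sym (combine-remQuot {suc h} (suc g) s))
        (trans (cong (uncurry combine) (×-≡,≡→≡ (a-injective _ _ _ _ eq)))
               (combine-remQuot {suc h} (suc g) t))

-- From disjoint translates to grids

sum-table⇒parallelogram : ∀ {n h g} (x : Fin (suc h) → ℤ) (k : Fin (suc g) → ℤ)
  (a : Fin (suc h) → Fin (suc g) → Fin n) → (∀ j i → x j ℤ.+ k i ≡ value (a j i)) →
  ∀ j i → toℕ (a j i) + toℕ (a zero zero) ≡ toℕ (a j zero) + toℕ (a zero i)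
-- `value` adds 1 to each index, so both sides carry two extra successors.
sum-table⇒parallelogram x k a a≡ j i = suc-injective (suc-injective (begin
  suc (suc (toℕ (a j i) + toℕ (a zero zero)))   ≡⟨ cong suc (sym (+-suc (toℕ (a j i)) _)) ⟩
  suc (toℕ (a j i)) + suc (toℕ (a zero zero))   ≡⟨ ℤ.+-injective integers ⟩
  suc (toℕ (a j zero)) + suc (toℕ (a zero i))   ≡⟨ cong suc (+-suc (toℕ (a j zero)) _) ⟩
  suc (suc (toℕ (a j zero) + toℕ (a zero i)))   ∎))
  where
  open ≡-Reasoning
  exchange : ∀ x k y l → (x ℤ.+ k) ℤ.+ (y ℤ.+ l) ≡ (x ℤ.+ l) ℤ.+ (y ℤ.+ k)
  exchange = ℤ-Solver.solve-∀
  integers : value (a j i) ℤ.+ value (a zero zero) ≡ value (a j zero) ℤ.+ value (a zero i)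
  integers = trans (sym (cong₂ ℤ._+_ (a≡ j i) (a≡ zero zero)))
    (trans (exchange (x j) (k i) (x zero) (k zero)) (cong₂ ℤ._+_ (a≡ j zero) (a≡ zero i)))

-- A degenerate grid can be a single point, which a nonempty set cannot avoid; therefore only grids
-- of full size are forbidden. The sides are `suc h` and `suc g`.
GridFree : ∀ {n} h g → Subset n → Set
GridFree {n} h g A = ∀ {e} → e ∈ grids n h g → suc h * suc g ≤ ∣ e ∣ → e ⊈ₛ A

-- The points of `A` that represent the sums form a table. Its grid is listed, has full size because
-- the sums are distinct, and lies in `A`.
gridFree⇒¬sum-table : ∀ {n h g} {A : Subset n} → GridFree h g A →
  (x : Fin (suc h) → ℤ) (k : Fin (suc g) → ℤ) →
  (∀ j i j′ i′ → x j ℤ.+ k i ≡ x j′ ℤ.+ k i′ → j ≡ j′ × i ≡ i′) →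
  ¬ (∀ j i → ∃[ v ] v ∈ₛ A × x j ℤ.+ k i ≡ value v)
gridFree⇒¬sum-table {n} {h} {g} {A} free x k sums-injective point =
  free {gridOf a} (gridOf∈grids a)
    (∣gridOf∣≥ a parallelogram a-injective) (gridOf⊆ a parallelogram (λ j i → proj₁ (proj₂ (point j i))))
  where
  a : Fin (suc h) → Fin (suc g) → Fin n
  a j i = proj₁ (point j i)
  a≡ : ∀ j i → x j ℤ.+ k i ≡ value (a j i)
  a≡ j i = proj₂ (proj₂ (point j i))
  parallelogram : ∀ j i → toℕ (a j i) + toℕ (a zero zero) ≡ toℕ (a j zero) + toℕ (a zero i)
  parallelogram = sum-table⇒parallelogram x k a a≡
  a-injective : ∀ j i j′ i′ → a j i ≡ a j′ i′ → j ≡ j′ × i ≡ i′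
  a-injective j i j′ i′ eq =
    sums-injective j i j′ i′ (trans (a≡ j i) (trans (cong value eq) (sym (a≡ j′ i′))))

-- The elements of the translates form the forbidden table. Equal sums within one translate come
-- from equal positions in `X`; equal sums in different translates contradict disjointness.
gridFree⇒WeakC : ∀ {n h g} {A : Subset n} → GridFree h g A → WeakC (suc h) (suc g) (_∈ values A)
gridFree⇒WeakC {A = A} free X@(_ ∷ _) unique refl (k , _ , disjoint , X+k⊆A) =
  gridFree⇒¬sum-table free (lookup X) k sums-injective
    (λ j i → ∈-values⁻ A (All.lookup (X+k⊆A i) (sum∈ j i)))
  where
  sum∈ : ∀ j i → (lookup X j ℤ.+ k i) ∈ translate X (k i)
  sum∈ j i = ∈-map⁺ (ℤ._+ k i) (∈-lookup j)
  sums-injective : ∀ j i j′ i′ → lookup X j ℤ.+ k i ≡ lookup X j′ ℤ.+ k i′ → j ≡ j′ × i ≡ i′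
  sums-injective j i j′ i′ eq with i Fin.≟ i′
  ... | yes refl = lookup-injective unique (ℤ-Group.∙-cancelʳ (k i) _ _ eq) , refl
  ... | no i≢i′  = contradiction
    (sum∈ j i , subst (_∈ translate X (k i′)) (sym eq) (sum∈ j′ i′)) (disjoint i i′ i≢i′)

-- Integer roots

^-distribʳ-* : ∀ m n d → (m * n) ^ d ≡ m ^ d * n ^ d
^-distribʳ-* m n zero    = refl
^-distribʳ-* m n (suc d) = trans (cong (m * n *_) (^-distribʳ-* m n d)) (rearrange m n (m ^ d) (n ^ d))
  where
  rearrange : ∀ m n x y → m * n * (x * y) ≡ m * x * (n * y)
  rearrange = solve-∀

^-cancelʳ-≤ : ∀ d .{{_ : NonZero d}} {m n} → m ^ d ≤ n ^ d → m ≤ n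
^-cancelʳ-≤ d m^d≤n^d = ≮⇒≥ λ n<m → <⇒≱ (^-monoˡ-< d n<m) m^d≤n^d

-- Induction on `N`: the root stays at `m` until the next power `suc m ^ d` is reached, and then
-- grows by one.
floor-root : ∀ d .{{_ : NonZero d}} N → ∃[ m ] m ^ d ≤ N × suc N ≤ suc m ^ d
floor-root d@(suc _) zero    = 0 , z≤n , m^n>0 1 d
floor-root d         (suc N) with floor-root d N
... | m , lower , upper with suc N <? suc m ^ d
... | yes N<  = m , m≤n⇒m≤1+n lower , N<
... | no  N≮ = suc m , ≮⇒≥ N≮ , ≤-<-trans upper (^-monoˡ-< d (n<1+n (suc m)))

-- The floor root `m` of the predecessor makes `suc m` the root rounded up. For positive `m`
-- rounding at most doubles it, and for `m` zero the root is 1. The form `suc q` fits the density 1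
-- / (1 + q).
ceiling-root : ∀ d .{{_ : NonZero d}} N → 1 ≤ N →
  ∃[ q ] N ≤ suc q ^ d × suc q ^ d ≤ 2 ^ d * N
ceiling-root d (suc N) _ with floor-root d N
... | m , lower , upper = m , upper , double m lower
  where
  double : ∀ m → m ^ d ≤ N → suc m ^ d ≤ 2 ^ d * suc N
  double zero    _     = ≤-trans (^-monoˡ-≤ d (s≤s (z≤n {1}))) (m≤m*n (2 ^ d) (suc N))
  double (suc m) lower = begin
    suc (suc m) ^ d    ≤⟨ ^-monoˡ-≤ d (s≤s (≤-trans (m≤m+n (suc m) 0) (m≤n+m (suc m + 0) m))) ⟩
    (2 * suc m) ^ d    ≡⟨ ^-distribʳ-* 2 (suc m) d ⟩
    2 ^ d * suc m ^ d  ≤⟨ *-monoʳ-≤ (2 ^ d) (m≤n⇒m≤1+n lower) ⟩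
    2 ^ d * suc N      ∎
    where open ≤-Reasoning

-- Rational powers and the exponent

toℚᵘ-/ : ∀ i n .{{_ : NonZero n}} → toℚᵘ (i ℚ./ n) ≃ i ℚᵘ./ n
toℚᵘ-/ i (suc n) = ℚ.toℚᵘ-fromℚᵘ (mkℚᵘ i n)

fromℕ-* : ∀ m n → fromℕ (m * n) ≡ fromℕ m ℚ.* fromℕ n
fromℕ-* m n = ℚ.toℚᵘ-injective (begin-equality
  toℚᵘ (fromℕ (m * n))              ≃⟨ toℚᵘ-/ (+ (m * n)) 1 ⟩
  mkℚᵘ (+ (m * n)) 0                ≃⟨ *≡* (cong (ℤ._* + 1) (ℤ.pos-* m n)) ⟩
  mkℚᵘ (+ m) 0 ℚᵘ.* mkℚᵘ (+ n) 0    ≃⟨ ℚᵘ.*-cong (toℚᵘ-/ (+ m) 1) (toℚᵘ-/ (+ n) 1) ⟨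
  toℚᵘ (fromℕ m) ℚᵘ.* toℚᵘ (fromℕ n) ≃⟨ ℚ.toℚᵘ-homo-* (fromℕ m) (fromℕ n) ⟨
  toℚᵘ (fromℕ m ℚ.* fromℕ n)        ∎)
  where open ℚᵘ.≤-Reasoning

fromℕ-^ : ∀ m d → fromℕ (m ^ d) ≡ fromℕ m ^ℚ d
fromℕ-^ m zero    = refl
fromℕ-^ m (suc d) = trans (fromℕ-* m (m ^ d)) (cong (fromℕ m ℚ.*_) (fromℕ-^ m d))

fromℕ-mono-≤ : ∀ {m n} → m ≤ n → fromℕ m ℚ.≤ fromℕ n
fromℕ-mono-≤ {m} {n} m≤n = ℚ.toℚᵘ-cancel-≤ (begin
  toℚᵘ (fromℕ m) ≃⟨ toℚᵘ-/ (+ m) 1 ⟩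
  mkℚᵘ (+ m) 0   ≤⟨ ℚᵘ.*≤* (ℤ.*-monoʳ-≤-nonNeg (+ 1) (ℤ.+≤+ m≤n)) ⟩
  mkℚᵘ (+ n) 0   ≃⟨ toℚᵘ-/ (+ n) 1 ⟨
  toℚᵘ (fromℕ n) ∎)
  where open ℚᵘ.≤-Reasoning

-- One factor 2 pays for the deletion, one for rounding the root, and one bounds the d-th root of
-- the 2 in `2 * n ^ (h + g)`.
⅛ : ℚ
⅛ = + 1 ℚ./ 8

⅛^d-nonNegative : ∀ d → ℚ.NonNegative (⅛ ^ℚ d)
⅛^d-nonNegative zero    = _
⅛^d-nonNegative (suc d) = ℚ.nonNeg*nonNeg⇒nonNeg ⅛ (⅛ ^ℚ d) {{⅛^d-nonNegative d}}

-- `AtLeastPower` reads the exponent in lowest terms p / q, whereas the counting yields the fraction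
-- s / d. Since p d = s q, raising to the power q and taking d-th roots passes from one to the
-- other.
n^s≤[8m]^d⇒atLeastPower : ∀ {m n} (e : ℚ) s d .{{_ : NonZero d}} →
  toℚᵘ e ≃ + s ℚᵘ./ d → n ^ s ≤ (8 * m) ^ d → AtLeastPower m ⅛ n e
-- A negative numerator is impossible, as the exponent equals the nonnegative s / d.
n^s≤[8m]^d⇒atLeastPower (mkℚ -[1+ p ] q-1 _) s (suc d) (*≡* eq) bound
  = contradiction (trans eq (sym (ℤ.pos-* s (suc q-1)))) λ ()
n^s≤[8m]^d⇒atLeastPower {m} {n} (mkℚ (+ p) q-1 _) s d@(suc _) (*≡* eq) bound = begin
  ⅛ ^ℚ q ℚ.* fromℕ n ^ℚ p                    ≡⟨ cong (⅛ ^ℚ q ℚ.*_) (sym (fromℕ-^ n p)) ⟩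
  ⅛ ^ℚ q ℚ.* fromℕ (n ^ p)                   ≤⟨ ℚ.*-monoˡ-≤-nonNeg (⅛ ^ℚ q) {{⅛^d-nonNegative q}} (fromℕ-mono-≤ n^p≤[8m]^q) ⟩
  ⅛ ^ℚ q ℚ.* fromℕ ((8 * m) ^ q)             ≡⟨ cong (⅛ ^ℚ q ℚ.*_) (fromℕ-^ (8 * m) q) ⟩
  ⅛ ^ℚ q ℚ.* fromℕ (8 * m) ^ℚ q              ≡⟨ sym (^-distrib-* ⅛ (fromℕ (8 * m)) q) ⟩
  (⅛ ℚ.* fromℕ (8 * m)) ^ℚ q                 ≡⟨ cong (λ x → (⅛ ℚ.* x) ^ℚ q) (fromℕ-* 8 m) ⟩
  (⅛ ℚ.* (fromℕ 8 ℚ.* fromℕ m)) ^ℚ q         ≡⟨ cong (_^ℚ q) (sym (ℚ.*-assoc ⅛ (fromℕ 8) (fromℕ m))) ⟩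
  (1ℚ ℚ.* fromℕ m) ^ℚ q                      ≡⟨ cong (_^ℚ q) (ℚ.*-identityˡ (fromℕ m)) ⟩
  fromℕ m ^ℚ q                               ∎
  where
  open ℚ.≤-Reasoning
  q = suc q-1
  p*d≡s*q : p * d ≡ s * q
  p*d≡s*q = ℤ.+-injective (trans (ℤ.pos-* p d) (trans eq (sym (ℤ.pos-* s q))))
  n^p≤[8m]^q : n ^ p ≤ (8 * m) ^ q
  n^p≤[8m]^q = ^-cancelʳ-≤ d (≤R.begin
    (n ^ p) ^ d         ≤R.≡⟨ trans (^-*-assoc n p d) (cong (n ^_) p*d≡s*q) ⟩
    n ^ (s * q)         ≤R.≡⟨ sym (^-*-assoc n s q) ⟩
    (n ^ s) ^ q         ≤R.≤⟨ ^-monoˡ-≤ q bound ⟩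
    ((8 * m) ^ d) ^ q   ≤R.≡⟨ trans (^-*-assoc (8 * m) d q) (trans (cong ((8 * m) ^_) (*-comm d q)) (sym (^-*-assoc (8 * m) q d))) ⟩
    ((8 * m) ^ q) ^ d   ≤R.∎)
    where module ≤R = ≤-Reasoning

1-1/[1+m]≃m/[1+m] : ∀ m → toℚᵘ (1ℚ ℚ.- + 1 ℚ./ suc m) ≃ mkℚᵘ (+ m) m
1-1/[1+m]≃m/[1+m] m = begin-equality
  toℚᵘ (1ℚ ℚ.- + 1 ℚ./ suc m)                      ≃⟨ ℚ.toℚᵘ-homo-+ 1ℚ (ℚ.- (+ 1 ℚ./ suc m)) ⟩
  toℚᵘ 1ℚ ℚᵘ.+ toℚᵘ (ℚ.- (+ 1 ℚ./ suc m))          ≃⟨ ℚᵘ.+-congʳ (toℚᵘ 1ℚ) (ℚ.toℚᵘ-homo‿- (+ 1 ℚ./ suc m)) ⟩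
  toℚᵘ 1ℚ ℚᵘ.- toℚᵘ (+ 1 ℚ./ suc m)                ≃⟨ ℚᵘ.+-congʳ (toℚᵘ 1ℚ) (ℚᵘ.-‿cong (toℚᵘ-/ (+ 1) (suc m))) ⟩
  toℚᵘ 1ℚ ℚᵘ.- mkℚᵘ (+ 1) m                        ≃⟨ *≡* (cong₂ (λ k l → + k ℤ.* + suc l) (+-identityʳ m) (sym (+-identityʳ m))) ⟩
  mkℚᵘ (+ m) m                                     ∎
  where open ℚᵘ.≤-Reasoning

1+1/d≃[1+d]/d : ∀ d → toℚᵘ (1ℚ ℚ.+ + 1 ℚ./ suc d) ≃ mkℚᵘ (+ suc (suc d)) d
1+1/d≃[1+d]/d d = begin-equality
  toℚᵘ (1ℚ ℚ.+ + 1 ℚ./ suc d)             ≃⟨ ℚ.toℚᵘ-homo-+ 1ℚ (+ 1 ℚ./ suc d) ⟩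
  toℚᵘ 1ℚ ℚᵘ.+ toℚᵘ (+ 1 ℚ./ suc d)       ≃⟨ ℚᵘ.+-congʳ (toℚᵘ 1ℚ) (toℚᵘ-/ (+ 1) (suc d)) ⟩
  toℚᵘ 1ℚ ℚᵘ.+ mkℚᵘ (+ 1) d               ≃⟨ *≡* (cong +_ (rearrange d)) ⟩
  mkℚᵘ (+ suc (suc d)) d                  ∎
  where
  open ℚᵘ.≤-Reasoning
  rearrange : ∀ d → (1 * suc d + 1 * 1) * suc d ≡ suc (suc d) * (1 * suc d)
  rearrange = solve-∀

-- The third factor is hg / (hg - 1) in the theorem's letters; its numerator cancels the
-- denominators of the first two.
exponent≃ : ∀ h g (2≤h : 2 ≤ suc (suc h)) (h≤g : suc (suc h) ≤ suc (suc g)) →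
  toℚᵘ (exponent (suc (suc h)) (suc (suc g)) 2≤h h≤g) ≃
  + (suc h * suc g) ℚᵘ./ (suc g + suc h * suc (suc g))
exponent≃ h g 2≤h h≤g = begin-equality
  toℚᵘ (x ℚ.* y ℚ.* z)                 ≃⟨ ℚ.toℚᵘ-homo-* (x ℚ.* y) z ⟩
  toℚᵘ (x ℚ.* y) ℚᵘ.* toℚᵘ z           ≃⟨ ℚᵘ.*-congʳ (ℚ.toℚᵘ-homo-* x y) ⟩
  toℚᵘ x ℚᵘ.* toℚᵘ y ℚᵘ.* toℚᵘ z       ≃⟨ ℚᵘ.*-cong (ℚᵘ.*-cong (1-1/[1+m]≃m/[1+m] (suc h)) (1-1/[1+m]≃m/[1+m] (suc g))) (1+1/d≃[1+d]/d d) ⟩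
  mkℚᵘ (+ suc h) (suc h) ℚᵘ.* mkℚᵘ (+ suc g) (suc g) ℚᵘ.* mkℚᵘ (+ suc (suc d)) d
                                       ≃⟨ *≡* (cong +_ (rearrange (suc h) (suc g))) ⟩
  mkℚᵘ (+ (suc h * suc g)) d           ∎
  where
  open ℚᵘ.≤-Reasoning
  -- `mkℚᵘ` stores a denominator minus one, so `suc d` is the number hg - 1 of the theorem.
  d = g + suc h * suc (suc g)
  x y z : ℚ
  x = 1ℚ ℚ.- + 1 ℚ./ suc (suc h)
  y = 1ℚ ℚ.- + 1 ℚ./ suc (suc g)
  z = 1ℚ ℚ.+ + 1 ℚ./ suc d
  rearrange : ∀ h g → (h * g * suc (g + h * suc g)) * (g + h * suc g) ≡ h * g * ((suc h * suc g) * (g + h * suc g))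
  rearrange = solve-∀

-- Choice of the density and the final estimate

n^hg≤[8m]^d : ∀ {n m M} h g → let d = g + h * suc g in .{{_ : NonZero d}} → 1 ≤ n →
  M ^ d ≤ 2 ^ d * (2 * n ^ (h + g)) → n ≤ 2 * M * m → n ^ (h * g) ≤ (8 * m) ^ d
-- The factor `n ^ (h + g)` turns the left side into `n ^ d`, because hg + h + g = (h + 1)(g + 1) -
-- 1 = d.
n^hg≤[8m]^d {n} {m} {M} h g 1≤n M^d≤ n≤2Mm =
  *-cancelʳ-≤ _ _ (n ^ (h + g)) {{m^n≢0 n (h + g) {{>-nonZero 1≤n}}}} (begin
    n ^ (h * g) * n ^ (h + g)                              ≡⟨ sym (^-distribˡ-+-* n (h * g) (h + g)) ⟩
    n ^ (h * g + (h + g))                                  ≡⟨ cong (n ^_) (exponents h g) ⟩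
    n ^ d                                                  ≤⟨ ^-monoˡ-≤ d n≤2Mm ⟩
    (2 * M * m) ^ d                                        ≡⟨ ^-distribʳ-* (2 * M) m d ⟩
    (2 * M) ^ d * m ^ d                                    ≡⟨ cong (_* m ^ d) (^-distribʳ-* 2 M d) ⟩
    2 ^ d * M ^ d * m ^ d                                  ≤⟨ *-monoˡ-≤ (m ^ d) (*-monoʳ-≤ (2 ^ d) M^d≤) ⟩
    -- The single 2 is enlarged to `2 ^ d`, so that the constants combine to `8 ^ d`.
    2 ^ d * (2 ^ d * (2 * n ^ (h + g))) * m ^ d            ≤⟨ *-monoˡ-≤ (m ^ d) (*-monoʳ-≤ (2 ^ d) (*-monoʳ-≤ (2 ^ d) (*-monoˡ-≤ (n ^ (h + g)) 2≤2^d))) ⟩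
    2 ^ d * (2 ^ d * (2 ^ d * n ^ (h + g))) * m ^ d        ≡⟨ rearrange (2 ^ d) (n ^ (h + g)) (m ^ d) ⟩
    2 ^ d * (2 ^ d * 2 ^ d) * m ^ d * n ^ (h + g)          ≡⟨ cong (λ x → 2 ^ d * x * m ^ d * n ^ (h + g)) (sym (^-distribʳ-* 2 2 d)) ⟩
    2 ^ d * 4 ^ d * m ^ d * n ^ (h + g)                    ≡⟨ cong (λ x → x * m ^ d * n ^ (h + g)) (sym (^-distribʳ-* 2 4 d)) ⟩
    8 ^ d * m ^ d * n ^ (h + g)                            ≡⟨ cong (_* n ^ (h + g)) (sym (^-distribʳ-* 8 m d)) ⟩
    (8 * m) ^ d * n ^ (h + g)                              ∎)
  where
  open ≤-Reasoning
  d = g + h * suc g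
  exponents : ∀ h g → h * g + (h + g) ≡ g + h * suc g
  exponents = solve-∀
  2≤2^d : 2 ≤ 2 ^ d
  2≤2^d = ^-monoʳ-≤ 2 (ℕ.>-nonZero⁻¹ d)
  rearrange : ∀ x y z → x * (x * (x * y)) * z ≡ x * (x * x) * z * y
  rearrange = solve-∀

-- The exponent `suc h * suc g` is one more than `g + h * suc g`, so a factor `n * M` splits off
-- both sides and the hypothesis on `M` remains.
few-grids : ∀ n h g M → 2 * n ^ (h + g) ≤ M ^ (g + h * suc g) →
  2 * length (grids n h g) * M ≤ n * M ^ (suc h * suc g)
few-grids n h g M lower = begin
  2 * length (grids n h g) * M        ≡⟨ cong (λ l → 2 * l * M) (length-grids n h g) ⟩
  2 * (n * n ^ h * n ^ g) * M         ≡⟨ rearrange n (n ^ h) (n ^ g) M ⟩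
  n * (M * (2 * (n ^ h * n ^ g)))     ≡⟨ cong (λ x → n * (M * (2 * x))) (sym (^-distribˡ-+-* n h g)) ⟩
  n * (M * (2 * n ^ (h + g)))         ≤⟨ *-monoʳ-≤ n (*-monoʳ-≤ M lower) ⟩
  n * M ^ (suc h * suc g)             ∎
  where
  open ≤-Reasoning
  rearrange : ∀ n x y M → 2 * (n * x * y) * M ≡ n * (M * (2 * (x * y)))
  rearrange = solve-∀

-- Filtering out the small edges only shortens the list, so the bound on its length survives.
large-set-avoiding-big-edges : ∀ q {n r} (es : List (Subset n)) → 1 ≤ r →
  2 * length es * suc q ≤ n * suc q ^ r →
  ∃[ B ] (∀ {e} → e ∈ es → r ≤ ∣ e ∣ → e ⊈ₛ B) × n ≤ 2 * suc q * ∣ B ∣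
large-set-avoiding-big-edges q {n} {r} es 1≤r few = B ,
  (λ e∈ r≤∣e∣ → All.lookup (proj₁ (proj₂ independent)) (∈-filter⁺ big? e∈ r≤∣e∣)) ,
  proj₂ (proj₂ independent)
  where
  big? : Decidable {A = Subset n} (λ e → r ≤ ∣ e ∣)
  big? e = r ≤? ∣ e ∣
  independent = large-independent-set q (filter big? es) 1≤r (All.all-filter big? es)
    (≤-trans (*-monoˡ-≤ (suc q) (*-monoʳ-≤ 2 (length-filter big? es))) few)
  B = proj₁ independent

large-gridFree-set : ∀ h g .{{_ : NonZero (g + h * suc g)}} n → 1 ≤ n →
  ∃[ A ] GridFree {n} h g A × n ^ (h * g) ≤ (8 * ∣ A ∣) ^ (g + h * suc g)
large-gridFree-set h g n 1≤n = A , free , n^hg≤[8m]^d {M = suc q} h g 1≤n upper n≤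
  where
  -- `suc q` is the root of `2 * n ^ (h + g)` rounded up: large enough for `few-grids`, and small
  -- enough for the estimate of `∣ A ∣`.
  root = ceiling-root (g + h * suc g) (2 * n ^ (h + g))
    (*-mono-≤ (s≤s (z≤n {1})) (m^n>0 n {{>-nonZero 1≤n}} (h + g)))
  q = proj₁ root
  lower = proj₁ (proj₂ root)
  upper = proj₂ (proj₂ root)
  avoiding = large-set-avoiding-big-edges q {r = suc h * suc g} (grids n h g) (s≤s z≤n)
    (few-grids n h g (suc q) lower)
  A = proj₁ avoiding
  free : GridFree h g A
  free = proj₁ (proj₂ avoiding)
  n≤ = proj₂ (proj₂ avoiding)

theorem2 : (g h : ℕ) (2≤h : 2 ℕ.≤ h) (h≤g : h ℕ.≤ g) →
    ∃[ c ] 0ℚ ℚ.< c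
    × ((n : ℕ) → 1 ℕ.≤ n →
    ∃[ A ] Unique A
    × All (λ a → + 1 ℤ.≤ a × a ℤ.≤ + n) A
    × WeakC h g (_∈ A)
    × AtLeastPower (length A) c n (exponent h g 2≤h h≤g))
theorem2 (suc (suc g)) (suc (suc h)) 2≤h@(s≤s (s≤s _)) h≤g@(s≤s (s≤s _)) = ⅛ , ℚ.positive⁻¹ ⅛ , set
  where
  e : ℚ
  e = exponent (suc (suc h)) (suc (suc g)) 2≤h h≤g
  Good : ℕ → List ℤ → Set
  Good n A = Unique A × All (λ a → + 1 ℤ.≤ a × a ℤ.≤ + n) A
    × WeakC (suc (suc h)) (suc (suc g)) (_∈ A) × AtLeastPower (length A) ⅛ n e
  set : ∀ n → 1 ≤ n → ∃[ A ] Good n A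
  set n 1≤n = values A , values-unique A , values-bounds A , gridFree⇒WeakC free ,
    subst (λ m → AtLeastPower m ⅛ n e) (sym (length-values A))
      (n^s≤[8m]^d⇒atLeastPower e (suc h * suc g) (suc g + suc h * suc (suc g))
        (exponent≃ h g 2≤h h≤g) bound)
    where
    -- Grids are indexed by their sides minus one, hence `suc h` and `suc g` for the sides
    -- `suc (suc h)` and `suc (suc g)`.
    gridFree = large-gridFree-set (suc h) (suc g) n 1≤n
    A = proj₁ gridFree
    free : GridFree (suc h) (suc g) A
    free = proj₁ (proj₂ gridFree)
    bound = proj₂ (proj₂ gridFree)
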